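{- There is an absolute constant $C>0$ such that for every integer $n\ge 2$ there exists a CPS instance $(E,\mathcal{I},a)$ with $|E|\le n$ and density at most $C/\log n$ that is not schedulable.
   Context: Let $\mathbb{N}=\{1,2,\dots\}$. An instance of Combinatorial Pinwheel Scheduling (CPS) is a triple $(E,\mathcal{I},a)$ where $E$ is a finite set, $\mathcal{I}\subseteq 2^E$ is a family of subsets of $E$, and $a\in\mathbb{N}^E$. It is schedulable if there is an infinite sequence $\pi(1),\pi(2),\dots$ of members of $\mathcal{I}$ such that for all $e\in E$ and all $t\in\mathbb{N}$ we have $e\in\bigcup_{i=t}^{t+a(e)-1}\pi(i)$. The density of $(E,\mathcal{I},a)$ is the minimum $\rho$ such that there exist $\lambda(I)\ge 0$ ($I\in\mathcal{I}$) with $\sum_{I\in\mathcal{I}}\lambda(I)=\rho$ and $\sum_{I\in\mathcal{I}:\,e\in I}\lambda(I)\ge 1/a(e)$ for all $e\in E$. -}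

module Defs where

open import Data.Fin using (Fin)
open import Data.Fin.Subset using (Subset) renaming (_∈_ to _∈ₛ_)
open import Data.Fin.Subset.Properties using () renaming (_∈?_ to _∈ₛ?_)
open import Data.Integer using (+_)
open import Data.List using (List; []; map; filter; foldr)
open import Data.List.Membership.Propositional using (_∈_)
open import Data.List.Relation.Unary.Unique.Propositional using (Unique)
open import Data.Nat as ℕ using (ℕ; NonZero)
open import Data.Product using (∃-syntax; Σ-syntax; _×_)
open import Data.Rational using (ℚ; 0ℚ; _+_; _*_; _/_; _≤_)
open import Relation.Binary.PropositionalEquality using (_≡_; _≢_)

-- The ground set E is Fin size, and the family ℐ ⊆ 2^E is a duplicate-free
-- list, so that summing over the list is summing over the members of ℐ.
--
-- ℐ is required to be nonempty.  This only rules out degenerate cases: when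
-- ℐ = ∅ there is no sequence in ℐ at all, and either E ≠ ∅ and the density is
-- undefined (infeasible), or E = ∅ and the density is 0.  Admitting the latter
-- would make the existence of sparse unschedulable instances trivial.
record CPS : Set where
  field
    size     : ℕ
    family   : List (Subset size)
    unique   : Unique family
    nonempty : family ≢ []
    period   : Fin size → ℕ
    {{period-nonZero}} : ∀ {e} → NonZero (period e)

open CPS public using (size)

module _ (P : CPS) where
  open CPS P hiding (size)

  -- Time starts at 0 rather than 1; the window [t , t + a(e) - 1] is written
  -- half-open.
  Schedulable : Set
  Schedulable =
    Σ[ π ∈ (ℕ → Subset (size P)) ]
      ((∀ t → π t ∈ family) ×
       (∀ e t → ∃[ i ] (t ℕ.≤ i × i ℕ.< t ℕ.+ period e × e ∈ₛ π i)))

  Weighting : Set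
  Weighting = Subset (size P) → ℚ

  weight : Weighting → List (Subset (size P)) → ℚ
  weight w Is = foldr _+_ 0ℚ (map w Is)

  Feasible : Weighting → Set
  Feasible w =
    (∀ I → I ∈ family → 0ℚ ≤ w I) ×
    (∀ e → (+ 1) / period e ≤ weight w (filter (e ∈ₛ?_) family))

  -- ρ is the minimum (attained) of the linear program.  Its data are rational,
  -- so its minimum over real weights is rational and attained by rational
  -- weights; ranging over ℚ gives the same value.
  IsDensity : ℚ → Set
  IsDensity ρ =
    (∃[ w ] (Feasible w × weight w family ≡ ρ)) ×
    (∀ w → Feasible w → ρ ≤ weight w family)

-- p / q ≤ log₂ n, for n ≥ 1 and q ≥ 1: the nonnegative part of the lower
-- Dedekind cut of the real number log₂ n.  The choice of base only rescales the
-- absolute constant in an O(1 / log n) bound.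
_over_≤log₂_ : ℕ → ℕ → ℕ → Set
p over q ≤log₂ n = 2 ℕ.^ p ℕ.≤ n ℕ.^ q

-- x ≤ C / log₂ n, for x ≥ 0, C ≥ 0 and n ≥ 2, in the form x · log₂ n ≤ C: the
-- real number log₂ n is the supremum of the rationals p / q in its lower cut.
_≤_/log₂_ : ℚ → ℚ → ℕ → Set
x ≤ C /log₂ n =
  ∀ (p q : ℕ) .{{_ : NonZero q}} → p over q ≤log₂ n → x * ((+ p) / q) ≤ C

{-# OPTIONS --safe #-}

-- Take all k-element subsets of a 2k-element set as the ground set E, let the
-- j-th member of ℐ consist of the k-subsets containing j, and let all periods
-- be k.  Any k members of ℐ miss a k-subset of the complement of their
-- indices, so no schedule exists.  Every e lies in k of the 2k members of ℐ,
-- so the constant weight 1/k² is feasible, with total 2/k.  Two complementary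
-- k-subsets lie in no common member of ℐ and each needs weight 1/k, so 2/k is
-- optimal.  Finally |E| = C(2k, k) ≤ 2^(2k-1), so the largest k with
-- 2^(2k-1) ≤ n has order log n.
module Submission where

open import Data.Fin as Fin using (Fin)
open import Data.Fin.Subset using (Subset; inside; outside; ⊥; ⁅_⁆; ∁; _∪_; _⊆_; ∣_∣) renaming (_∈_ to _∈ₛ_; _∉_ to _∉ₛ_)
open import Data.Fin.Subset.Properties using (∣⊥∣≡0; ∣⁅x⁆∣≡1; ∣∁p∣≡n∸∣p∣; x∈⁅x⁆; x∈⁅y⁆⇒x≡y; x∈∁p⇒x∉p; x∉p⇒x∈∁p; x∈p⇒∣p-x∣<∣p∣; p⊆q⇒∣p∣≤∣q∣; ∣p∣≤∣x∷p∣; x∈p∪q⁺; ⊥⊆; drop-∷-⊆; in⊆in; out⊆) renaming (_∈?_ to _∈ₛ?_)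
open import Data.Integer as ℤ using (+_)
import Data.Integer.Properties as ℤₚ
open import Data.List using (List; []; _∷_; [_]; _++_; map; filter; length; lookup; tabulate)
open import Data.List.Properties using (length-map; length-++; length-tabulate; filter-accept)
open import Data.List.Membership.Propositional using (_∈_)
open import Data.List.Membership.Propositional.Properties using (∈-map⁺; ∈-++⁺ˡ; ∈-++⁺ʳ; ∈-lookup; ∈-tabulate⁻)
open import Data.List.Relation.Unary.All as All using (All; []; _∷_)
import Data.List.Relation.Unary.All.Properties as Allₚ
open import Data.List.Relation.Unary.Any using (here; there; index)
open import Data.List.Relation.Unary.Any.Properties using (lookup-index)
open import Data.List.Relation.Unary.Unique.Propositional.Properties using (tabulate⁺)
open import Data.Nat as ℕ using (ℕ; zero; suc; s≤s; z≤n; NonZero)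
import Data.Nat.Properties as ℕₚ
open import Data.Product using (∃-syntax; _×_; _,_; proj₁; proj₂)
open import Data.Rational as ℚ using (ℚ; 0ℚ; 1ℚ; _<_; _/_; fromℚᵘ; toℚᵘ)
import Data.Rational.Properties as ℚₚ
open import Data.Rational.Unnormalised as ℚᵘ using (mkℚᵘ; *≡*; *≤*)
import Data.Rational.Unnormalised.Properties as ℚᵘₚ
open import Data.Sum using (inj₁; inj₂)
open import Data.Vec as Vec using ([]; _∷_; here; there)
import Data.Vec.Properties as Vecₚ
open import Function using (_∘_; const)
open import Relation.Binary.PropositionalEquality using (_≡_; refl; sym; trans; cong; cong₂; subst; module ≡-Reasoning)
open import Relation.Nullary using (¬_; yes; no; contradiction)
open import Relation.Unary using (Decidable)
open import Defs

-- Finite subsets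

private variable
  m : ℕ

∣p∪q∣≤∣p∣+∣q∣ : (p q : Subset m) → ∣ p ∪ q ∣ ℕ.≤ ∣ p ∣ ℕ.+ ∣ q ∣
∣p∪q∣≤∣p∣+∣q∣ [] [] = z≤n
∣p∪q∣≤∣p∣+∣q∣ (inside ∷ p) (y ∷ q) =
  s≤s (ℕₚ.≤-trans (∣p∪q∣≤∣p∣+∣q∣ p q) (ℕₚ.+-monoʳ-≤ ∣ p ∣ (∣p∣≤∣x∷p∣ y q)))
∣p∪q∣≤∣p∣+∣q∣ (outside ∷ p) (inside ∷ q) =
  ℕₚ.≤-trans (s≤s (∣p∪q∣≤∣p∣+∣q∣ p q)) (ℕₚ.≤-reflexive (sym (ℕₚ.+-suc ∣ p ∣ ∣ q ∣)))
∣p∪q∣≤∣p∣+∣q∣ (outside ∷ p) (outside ∷ q) = ∣p∪q∣≤∣p∣+∣q∣ p q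

image : (ℕ → Fin m) → ℕ → Subset m
image g zero    = ⊥
image g (suc k) = ⁅ g k ⁆ ∪ image g k

∣image∣≤ : (g : ℕ → Fin m) (k : ℕ) → ∣ image g k ∣ ℕ.≤ k
∣image∣≤ {m} g zero = ℕₚ.≤-reflexive (∣⊥∣≡0 m)
∣image∣≤ g (suc k) = ℕₚ.≤-trans (∣p∪q∣≤∣p∣+∣q∣ ⁅ g k ⁆ (image g k))
  (ℕₚ.+-mono-≤ (ℕₚ.≤-reflexive (∣⁅x⁆∣≡1 (g k))) (∣image∣≤ g k))

∈-image : (g : ℕ → Fin m) {k i : ℕ} → i ℕ.< k → g i ∈ₛ image g k
∈-image g {suc k} i<1+k with ℕₚ.m<1+n⇒m<n∨m≡n i<1+k
... | inj₁ i<k  = x∈p∪q⁺ (inj₂ (∈-image g i<k))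
... | inj₂ refl = x∈p∪q⁺ (inj₁ (x∈⁅x⁆ (g k)))

-- Each position in `p` survives the filter. Applied with `f = column` and `p = element e`, this
-- counts the members of the family through `e`.
∣p∣≤∣filter-tabulate∣ : ∀ {A : Set} {P : A → Set} (P? : Decidable P) (f : Fin m → A) (p : Subset m) →
  (∀ {j} → j ∈ₛ p → P (f j)) → ∣ p ∣ ℕ.≤ length (filter P? (tabulate f))
∣p∣≤∣filter-tabulate∣ P? f [] p⊆P = z≤n
∣p∣≤∣filter-tabulate∣ P? f (inside ∷ p) p⊆P
  rewrite filter-accept P? {xs = tabulate (f ∘ Fin.suc)} (p⊆P here) =
  s≤s (∣p∣≤∣filter-tabulate∣ P? (f ∘ Fin.suc) p (p⊆P ∘ there))
∣p∣≤∣filter-tabulate∣ P? f (outside ∷ p) p⊆P with P? (f Fin.zero)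
... | yes _ = ℕₚ.m≤n⇒m≤1+n (∣p∣≤∣filter-tabulate∣ P? (f ∘ Fin.suc) p (p⊆P ∘ there))
... | no  _ = ∣p∣≤∣filter-tabulate∣ P? (f ∘ Fin.suc) p (p⊆P ∘ there)

combinations : ℕ → (m : ℕ) → List (Subset m)
combinations zero    m       = [ ⊥ ]
combinations (suc k) zero    = []
combinations (suc k) (suc m) =
  map (inside ∷_) (combinations k m) ++ map (outside ∷_) (combinations (suc k) m)

-- By Pascal's rule the bound doubles with each new point, starting from a one-point set, which has
-- at most one subset of each size. The exponent is therefore one less than the number of points;
-- for `k = 1` the bound is 2, so the instance fits already when `n = 2`.
∣combinations∣≤2^ : ∀ k m → length (combinations k (suc m)) ℕ.≤ 2 ℕ.^ m
∣combinations∣≤2^ zero          m    = ℕₚ.m^n>0 2 m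
∣combinations∣≤2^ (suc zero)    zero = ℕₚ.≤-refl
∣combinations∣≤2^ (suc (suc k)) zero = z≤n
∣combinations∣≤2^ (suc k) (suc m) = begin
  length (map (inside ∷_) xs ++ map (outside ∷_) ys)                 ≡⟨ length-++ (map (inside ∷_) xs) ⟩
  length (map (inside ∷_) xs) ℕ.+ length (map (outside ∷_) ys)       ≡⟨ cong₂ ℕ._+_ (length-map _ xs) (length-map _ ys) ⟩
  length xs ℕ.+ length ys                                            ≤⟨ ℕₚ.+-mono-≤ (∣combinations∣≤2^ k m) (∣combinations∣≤2^ (suc k) m) ⟩
  2 ℕ.^ m ℕ.+ 2 ℕ.^ m                                                ≡⟨ cong (2 ℕ.^ m ℕ.+_) (sym (ℕₚ.+-identityʳ _)) ⟩
  2 ℕ.^ suc m                                                        ∎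
  where
  open ℕₚ.≤-Reasoning
  xs = combinations k (suc m)
  ys = combinations (suc k) (suc m)

combinations-size : ∀ k m → All (λ p → ∣ p ∣ ≡ k) (combinations k m)
combinations-size zero    m       = ∣⊥∣≡0 m ∷ []
combinations-size (suc k) zero    = []
combinations-size (suc k) (suc m) = Allₚ.++⁺
  (Allₚ.map⁺ (All.map (cong suc) (combinations-size k m)))
  (Allₚ.map⁺ (combinations-size (suc k) m))

-- Walk through the points: a point of `s` outside `r` is left out as long as the rest of `s` can
-- still supply enough points, and is taken otherwise. Every k-subset with prescribed behaviour
-- below comes from a choice of `r` and `s` here.
combination-between : ∀ k (r s : Subset m) → r ⊆ s → ∣ r ∣ ℕ.≤ k → k ℕ.≤ ∣ s ∣ →
  ∃[ p ] (p ∈ combinations k m × r ⊆ p × p ⊆ s)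
combination-between zero r s r⊆s ∣r∣≤0 _ =
  ⊥ , here refl , (λ x∈r → contradiction (ℕₚ.≤-trans (x∈p⇒∣p-x∣<∣p∣ x∈r) ∣r∣≤0) λ ()) , ⊥⊆
combination-between (suc k) [] [] _ _ ()
combination-between (suc k) (inside ∷ r) (outside ∷ s) r⊆s _ _ = contradiction (r⊆s here) λ ()
combination-between (suc k) (inside ∷ r) (inside ∷ s) r⊆s (s≤s ∣r∣≤k) (s≤s k≤∣s∣)
  with p , p∈ , r⊆p , p⊆s ← combination-between k r s (drop-∷-⊆ r⊆s) ∣r∣≤k k≤∣s∣ =
  inside ∷ p , ∈-++⁺ˡ (∈-map⁺ _ p∈) , in⊆in r⊆p , in⊆in p⊆s
combination-between (suc k) (outside ∷ r) (outside ∷ s) r⊆s ∣r∣≤k k≤∣s∣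
  with p , p∈ , r⊆p , p⊆s ← combination-between (suc k) r s (drop-∷-⊆ r⊆s) ∣r∣≤k k≤∣s∣ =
  outside ∷ p , ∈-++⁺ʳ _ (∈-map⁺ _ p∈) , out⊆ r⊆p , out⊆ p⊆s
combination-between (suc k) (outside ∷ r) (inside ∷ s) r⊆s ∣r∣≤k (s≤s k≤∣s∣) with suc k ℕ.≤? ∣ s ∣
... | yes k<∣s∣
  with p , p∈ , r⊆p , p⊆s ← combination-between (suc k) r s (drop-∷-⊆ r⊆s) ∣r∣≤k k<∣s∣ =
  outside ∷ p , ∈-++⁺ʳ _ (∈-map⁺ _ p∈) , out⊆ r⊆p , out⊆ p⊆s
-- The tail `s` now has exactly `k` points, so the current point must be taken. The tail `r` lies in
-- `s` and hence meets the smaller size limit of the recursive call.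
... | no k≮∣s∣
  with p , p∈ , r⊆p , p⊆s ← combination-between k r s (drop-∷-⊆ r⊆s)
         (ℕₚ.≤-trans (p⊆q⇒∣p∣≤∣q∣ (drop-∷-⊆ r⊆s)) (ℕₚ.≮⇒≥ k≮∣s∣)) k≤∣s∣ =
  inside ∷ p , ∈-++⁺ˡ (∈-map⁺ _ p∈) , out⊆ r⊆p , in⊆in p⊆s

-- Rational arithmetic

fromℕ : ℕ → ℚ
fromℕ n = + n / 1

fromℚᵘ-mono-≤ : ∀ {p q} → p ℚᵘ.≤ q → fromℚᵘ p ℚ.≤ fromℚᵘ q
fromℚᵘ-mono-≤ {p} {q} p≤q = ℚₚ.toℚᵘ-cancel-≤
  (ℚᵘₚ.≤-respˡ-≃ (ℚᵘₚ.≃-sym (ℚₚ.toℚᵘ-fromℚᵘ p)) (ℚᵘₚ.≤-respʳ-≃ (ℚᵘₚ.≃-sym (ℚₚ.toℚᵘ-fromℚᵘ q)) p≤q))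

/≤fromℕ : ∀ p q r .{{_ : NonZero q}} → p ℕ.≤ r ℕ.* q → + p / q ℚ.≤ fromℕ r
/≤fromℕ p (suc q) r p≤rq = fromℚᵘ-mono-≤ {mkℚᵘ (+ p) q} {mkℚᵘ (+ r) 0} (*≤* (begin
  + p ℤ.* + 1      ≡⟨ ℤₚ.*-identityʳ (+ p) ⟩
  + p              ≤⟨ ℤ.+≤+ p≤rq ⟩
  + (r ℕ.* suc q)  ≡⟨ ℤₚ.pos-* r (suc q) ⟩
  + r ℤ.* + suc q  ∎))
  where open ℤₚ.≤-Reasoning

fromℕ-mono-≤ : ∀ {m n} → m ℕ.≤ n → fromℕ m ℚ.≤ fromℕ n
fromℕ-mono-≤ {m} {n} m≤n = /≤fromℕ m 1 n (ℕₚ.≤-trans m≤n (ℕₚ.≤-reflexive (sym (ℕₚ.*-identityʳ n))))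

fromℕ-+ : ∀ m n → fromℕ (m ℕ.+ n) ≡ fromℕ m ℚ.+ fromℕ n
fromℕ-+ m n = ℚₚ.toℚᵘ-injective (begin
  toℚᵘ (fromℕ (m ℕ.+ n))              ≈⟨ ℚₚ.toℚᵘ-fromℚᵘ _ ⟩
  mkℚᵘ (+ (m ℕ.+ n)) 0                ≈⟨ *≡* (cong (ℤ._* + 1) (sym (cong₂ ℤ._+_ (ℤₚ.*-identityʳ (+ m)) (ℤₚ.*-identityʳ (+ n))))) ⟩
  mkℚᵘ (+ m) 0 ℚᵘ.+ mkℚᵘ (+ n) 0      ≈⟨ ℚᵘₚ.+-cong (ℚₚ.toℚᵘ-fromℚᵘ (mkℚᵘ (+ m) 0)) (ℚₚ.toℚᵘ-fromℚᵘ (mkℚᵘ (+ n) 0)) ⟨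
  toℚᵘ (fromℕ m) ℚᵘ.+ toℚᵘ (fromℕ n)  ≈⟨ ℚₚ.toℚᵘ-homo-+ (fromℕ m) (fromℕ n) ⟨
  toℚᵘ (fromℕ m ℚ.+ fromℕ n)          ∎)
  where open import Relation.Binary.Reasoning.Setoid ℚᵘₚ.≃-setoid

fromℕ-*-inverseʳ : ∀ k → fromℕ (suc k) ℚ.* (+ 1 / suc k) ≡ 1ℚ
fromℕ-*-inverseʳ k = ℚₚ.toℚᵘ-injective (begin
  toℚᵘ (fromℕ (suc k) ℚ.* (+ 1 / suc k))           ≈⟨ ℚₚ.toℚᵘ-homo-* (fromℕ (suc k)) (+ 1 / suc k) ⟩
  toℚᵘ (fromℕ (suc k)) ℚᵘ.* toℚᵘ (+ 1 / suc k)     ≈⟨ ℚᵘₚ.*-cong (ℚₚ.toℚᵘ-fromℚᵘ (mkℚᵘ (+ suc k) 0)) (ℚₚ.toℚᵘ-fromℚᵘ (mkℚᵘ (+ 1) k)) ⟩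
  mkℚᵘ (+ suc k) 0 ℚᵘ.* mkℚᵘ (+ 1) k               ≈⟨ ℚᵘₚ.*-inverseʳ (mkℚᵘ (+ suc k) 0) ⟩
  toℚᵘ 1ℚ                                          ∎)
  where open import Relation.Binary.Reasoning.Setoid ℚᵘₚ.≃-setoid

-- Weightings

module _ (P : CPS) where

  weight-const : ∀ c Is → weight P (const c) Is ≡ fromℕ (length Is) ℚ.* c
  weight-const c []       = sym (ℚₚ.*-zeroˡ c)
  weight-const c (I ∷ Is) = begin
    c ℚ.+ weight P (const c) Is                   ≡⟨ cong₂ ℚ._+_ (sym (ℚₚ.*-identityˡ c)) (weight-const c Is) ⟩
    1ℚ ℚ.* c ℚ.+ fromℕ (length Is) ℚ.* c          ≡⟨ ℚₚ.*-distribʳ-+ c 1ℚ (fromℕ (length Is)) ⟨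
    (1ℚ ℚ.+ fromℕ (length Is)) ℚ.* c              ≡⟨ cong (ℚ._* c) (sym (fromℕ-+ 1 (length Is))) ⟩
    fromℕ (suc (length Is)) ℚ.* c                 ∎
    where open ≡-Reasoning

  -- A member adds its weight to at most one of the two sums on the left, and a member in neither
  -- adds a nonnegative amount on the right. This is weak duality, with dual solution 1 on `e` and 1
  -- on `f`.
  weight-disjoint : ∀ (w : Weighting P) e f Is → (∀ I → I ∈ Is → 0ℚ ℚ.≤ w I) →
    (∀ I → I ∈ Is → e ∈ₛ I → f ∉ₛ I) →
    weight P w (filter (e ∈ₛ?_) Is) ℚ.+ weight P w (filter (f ∈ₛ?_) Is) ℚ.≤ weight P w Is
  weight-disjoint w e f []       _   _    = ℚₚ.≤-refl
  weight-disjoint w e f (I ∷ Is) w≥0 disj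
    with ih ← weight-disjoint w e f Is (λ J → w≥0 J ∘ there) (λ J → disj J ∘ there) | e ∈ₛ? I | f ∈ₛ? I
  ... | yes e∈I | yes f∈I = contradiction f∈I (disj I (here refl) e∈I)
  ... | yes _   | no _    = ℚₚ.≤-trans (ℚₚ.≤-reflexive (ℚₚ.+-assoc (w I) _ _)) (ℚₚ.+-monoʳ-≤ (w I) ih)
  ... | no _    | yes _   = begin
    a ℚ.+ (w I ℚ.+ b)  ≡⟨ ℚₚ.+-assoc a (w I) b ⟨
    a ℚ.+ w I ℚ.+ b    ≡⟨ cong (ℚ._+ b) (ℚₚ.+-comm a (w I)) ⟩
    w I ℚ.+ a ℚ.+ b    ≡⟨ ℚₚ.+-assoc (w I) a b ⟩
    w I ℚ.+ (a ℚ.+ b)  ≤⟨ ℚₚ.+-monoʳ-≤ (w I) ih ⟩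
    w I ℚ.+ weight P w Is ∎
    where
    open ℚₚ.≤-Reasoning
    a = weight P w (filter (e ∈ₛ?_) Is)
    b = weight P w (filter (f ∈ₛ?_) Is)
  ... | no _    | no _    = ℚₚ.≤-trans ih
    (ℚₚ.≤-trans (ℚₚ.≤-reflexive (sym (ℚₚ.+-identityˡ _))) (ℚₚ.+-monoˡ-≤ _ (w≥0 I (here refl))))

-- The instance of density 2/k

module Instance (k-1 : ℕ) where

  -- The successor form makes `k` visibly nonzero, hence a legal period and denominator, and makes
  -- `k + k` a successor, as `∣combinations∣≤2^` requires.
  k = suc k-1
  ground = combinations k (k ℕ.+ k)

  element : Fin (length ground) → Subset (k ℕ.+ k)
  element = lookup ground

  -- Think of the incidence matrix with a row for each k-subset and a column for each of the `2k`
  -- points: the rows form the ground set and the columns the family.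
  column : Fin (k ℕ.+ k) → Subset (length ground)
  column j = Vec.tabulate (λ e → Vec.lookup (element e) j)

  ∈-column⁺ : ∀ e {j} → j ∈ₛ element e → e ∈ₛ column j
  ∈-column⁺ e {j} j∈e = Vecₚ.lookup⇒[]= e (column j) (trans (Vecₚ.lookup∘tabulate _ e) (Vecₚ.[]=⇒lookup j∈e))

  ∈-column⁻ : ∀ e {j} → e ∈ₛ column j → j ∈ₛ element e
  ∈-column⁻ e {j} e∈j = Vecₚ.lookup⇒[]= j (element e) (trans (sym (Vecₚ.lookup∘tabulate _ e)) (Vecₚ.[]=⇒lookup e∈j))

  element-between : ∀ r s → r ⊆ s → ∣ r ∣ ℕ.≤ k → k ℕ.≤ ∣ s ∣ → ∃[ e ] (r ⊆ element e × element e ⊆ s)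
  element-between r s r⊆s ∣r∣≤k k≤∣s∣
    with p , p∈ , r⊆p , p⊆s ← combination-between k r s r⊆s ∣r∣≤k k≤∣s∣ =
    index p∈ , subst (λ q → r ⊆ q × q ⊆ s) (lookup-index p∈) ((λ {x} → r⊆p {x}) , (λ {x} → p⊆s {x}))

  ∣element∣ : ∀ e → ∣ element e ∣ ≡ k
  ∣element∣ e = All.lookup (combinations-size k (k ℕ.+ k)) (∈-lookup {xs = ground} e)

  k≤∣∁_∣ : ∀ s → ∣ s ∣ ℕ.≤ k → k ℕ.≤ ∣ ∁ s ∣
  k≤∣∁_∣ s ∣s∣≤k = begin
    k                    ≡⟨ ℕₚ.m+n∸n≡m k k ⟨
    k ℕ.+ k ℕ.∸ k        ≤⟨ ℕₚ.∸-monoʳ-≤ (k ℕ.+ k) ∣s∣≤k ⟩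
    k ℕ.+ k ℕ.∸ ∣ s ∣    ≡⟨ ∣∁p∣≡n∸∣p∣ s ⟨
    ∣ ∁ s ∣              ∎
    where open ℕₚ.≤-Reasoning

  -- The complement of `s` in `2k` points still has `k` of them. This serves twice: with `s` the
  -- indices used in `k` time slots it defeats every schedule, and with `s` itself an element it
  -- yields the disjoint pair that bounds the density from below.
  element-avoiding : ∀ s → ∣ s ∣ ℕ.≤ k → ∃[ e ] (∀ {j} → j ∈ₛ s → j ∉ₛ element e)
  element-avoiding s ∣s∣≤k
    with e , _ , e⊆∁s ← element-between ⊥ (∁ s) ⊥⊆ (ℕₚ.≤-trans (ℕₚ.≤-reflexive (∣⊥∣≡0 (k ℕ.+ k))) z≤n) (k≤∣∁ s ∣ ∣s∣≤k) =
    e , λ j∈s j∈e → x∈∁p⇒x∉p (e⊆∁s j∈e) j∈s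

  ∣⁅x⁆∣≤k : (x : Fin (k ℕ.+ k)) → ∣ ⁅ x ⁆ ∣ ℕ.≤ k
  ∣⁅x⁆∣≤k x = ℕₚ.≤-trans (ℕₚ.≤-reflexive (∣⁅x⁆∣≡1 x)) (s≤s z≤n)

  -- Distinct points `i` and `j` are separated by a k-subset that contains `i` and avoids `j`. The
  -- family is thus free of duplicates.
  column-injective : ∀ {i j} → column i ≡ column j → i ≡ j
  column-injective {i} {j} eq with i Fin.≟ j
  ... | yes i≡j = i≡j
  ... | no  i≢j
    with e , ⁅i⁆⊆e , e⊆∁⁅j⁆ ← element-between ⁅ i ⁆ (∁ ⁅ j ⁆)
           (λ x∈⁅i⁆ → x∉p⇒x∈∁p λ x∈⁅j⁆ → i≢j (trans (sym (x∈⁅y⁆⇒x≡y i x∈⁅i⁆)) (x∈⁅y⁆⇒x≡y j x∈⁅j⁆)))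
           (∣⁅x⁆∣≤k i) (k≤∣∁ ⁅ j ⁆ ∣ (∣⁅x⁆∣≤k j)) =
    contradiction (x∈⁅x⁆ j) (x∈∁p⇒x∉p (e⊆∁⁅j⁆ (∈-column⁻ e (subst (e ∈ₛ_) eq (∈-column⁺ e (⁅i⁆⊆e (x∈⁅x⁆ i)))))))

  P : CPS
  P = record
    { size     = length ground
    ; family   = tabulate column
    ; unique   = tabulate⁺ column-injective
    ; nonempty = λ ()
    ; period   = const k
    }

  size≤ : size P ℕ.≤ 2 ℕ.^ (k-1 ℕ.+ k)
  size≤ = ∣combinations∣≤2^ k (k-1 ℕ.+ k)

  -- The window of `k` slots starting at time 0 already fails: `g` reads off which column is used at
  -- each time, and `e` avoids all indices seen in that window.
  ¬schedulable : ¬ Schedulable P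
  ¬schedulable (π , π∈ , covers) =
    let e , avoids        = element-avoiding (image g k) (∣image∣≤ g k)
        i , _ , i<k , e∈πi = covers e 0
    in avoids (∈-image g i<k) (∈-column⁻ e (subst (e ∈ₛ_) (proj₂ (∈-tabulate⁻ {f = column} (π∈ i))) e∈πi))
    where
    g : ℕ → Fin (k ℕ.+ k)
    g t = proj₁ (∈-tabulate⁻ {f = column} (π∈ t))

  -- Density of the instance

  u ρ : ℚ
  u = + 1 / k
  ρ = u ℚ.+ u

  instance
    u-nonNeg : ℚ.NonNegative u
    u-nonNeg = ℚₚ.normalize-nonNeg 1 k

    u²-nonNeg : ℚ.NonNegative (u ℚ.* u)
    u²-nonNeg = ℚₚ.nonNeg*nonNeg⇒nonNeg u u

    ρ-nonNeg : ℚ.NonNegative ρ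
    ρ-nonNeg = ℚₚ.nonNeg+nonNeg⇒nonNeg u u

  k*u² : fromℕ k ℚ.* (u ℚ.* u) ≡ u
  k*u² = begin
    fromℕ k ℚ.* (u ℚ.* u)  ≡⟨ ℚₚ.*-assoc (fromℕ k) u u ⟨
    fromℕ k ℚ.* u ℚ.* u    ≡⟨ cong (ℚ._* u) (fromℕ-*-inverseʳ k-1) ⟩
    1ℚ ℚ.* u               ≡⟨ ℚₚ.*-identityˡ u ⟩
    u                      ∎
    where open ≡-Reasoning

  uniform-feasible : Feasible P (const (u ℚ.* u))
  uniform-feasible = (λ _ _ → ℚₚ.nonNegative⁻¹ (u ℚ.* u)) , λ e →
    let L = filter (e ∈ₛ?_) (tabulate column) in begin
    u                               ≡⟨ k*u² ⟨
    fromℕ k ℚ.* (u ℚ.* u)           ≤⟨ ℚₚ.*-monoʳ-≤-nonNeg (u ℚ.* u) (fromℕ-mono-≤ (k≤∣filter∣ e)) ⟩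
    fromℕ (length L) ℚ.* (u ℚ.* u)  ≡⟨ weight-const P (u ℚ.* u) L ⟨
    weight P (const (u ℚ.* u)) L    ∎
    where
    open ℚₚ.≤-Reasoning
    k≤∣filter∣ : ∀ e → k ℕ.≤ length (filter (e ∈ₛ?_) (tabulate column))
    k≤∣filter∣ e = ℕₚ.≤-trans (ℕₚ.≤-reflexive (sym (∣element∣ e)))
      (∣p∣≤∣filter-tabulate∣ (e ∈ₛ?_) column (element e) (∈-column⁺ e))

  uniform-weight : weight P (const (u ℚ.* u)) (tabulate column) ≡ ρ
  uniform-weight = begin
    weight P (const (u ℚ.* u)) (tabulate column)                   ≡⟨ weight-const P (u ℚ.* u) (tabulate column) ⟩
    fromℕ (length (tabulate column)) ℚ.* (u ℚ.* u)                 ≡⟨ cong (λ l → fromℕ l ℚ.* (u ℚ.* u)) (length-tabulate column) ⟩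
    fromℕ (k ℕ.+ k) ℚ.* (u ℚ.* u)                                  ≡⟨ cong (ℚ._* (u ℚ.* u)) (fromℕ-+ k k) ⟩
    (fromℕ k ℚ.+ fromℕ k) ℚ.* (u ℚ.* u)                            ≡⟨ ℚₚ.*-distribʳ-+ (u ℚ.* u) (fromℕ k) (fromℕ k) ⟩
    fromℕ k ℚ.* (u ℚ.* u) ℚ.+ fromℕ k ℚ.* (u ℚ.* u)                ≡⟨ cong₂ ℚ._+_ k*u² k*u² ⟩
    ρ                                                              ∎
    where open ≡-Reasoning

  ρ≤weight : ∀ w → Feasible P w → ρ ℚ.≤ weight P w (tabulate column)
  ρ≤weight w (w≥0 , covers)
    -- Avoiding the empty set merely produces some element `e`; `f` is then a k-subset disjoint from
    -- it, so no column contains both.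
    with e , _ ← element-avoiding ⊥ (ℕₚ.≤-trans (ℕₚ.≤-reflexive (∣⊥∣≡0 (k ℕ.+ k))) z≤n)
    with f , disj ← element-avoiding (element e) (ℕₚ.≤-reflexive (∣element∣ e)) =
    ℚₚ.≤-trans (ℚₚ.+-mono-≤ (covers e) (covers f)) (weight-disjoint P w e f (tabulate column) w≥0 separated)
    where
    separated : ∀ I → I ∈ tabulate column → e ∈ₛ I → f ∉ₛ I
    separated I I∈ e∈I f∈I with j , refl ← ∈-tabulate⁻ {f = column} I∈ = disj (∈-column⁻ e e∈I) (∈-column⁻ f f∈I)

  isDensity : IsDensity P ρ
  isDensity = (const (u ℚ.* u) , uniform-feasible , uniform-weight) , ρ≤weight

  -- Comparison of the density with `log n`

  ρ*k : ρ ℚ.* fromℕ k ≡ fromℕ 2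
  ρ*k = begin
    ρ ℚ.* fromℕ k                      ≡⟨ ℚₚ.*-comm ρ (fromℕ k) ⟩
    fromℕ k ℚ.* ρ                      ≡⟨ ℚₚ.*-distribˡ-+ (fromℕ k) u u ⟩
    fromℕ k ℚ.* u ℚ.+ fromℕ k ℚ.* u    ≡⟨ cong₂ ℚ._+_ (fromℕ-*-inverseʳ k-1) (fromℕ-*-inverseʳ k-1) ⟩
    fromℕ 2                            ∎
    where open ≡-Reasoning

  -- The factor `3k` is a multiple of `k` that dominates `2k + 1`, the upper bound on `log₂ n`; it
  -- is the source of the constant 6.
  ρ*3k : ρ ℚ.* fromℕ (k ℕ.+ (k ℕ.+ k)) ≡ fromℕ 6
  ρ*3k = begin
    ρ ℚ.* fromℕ (k ℕ.+ (k ℕ.+ k))                         ≡⟨ cong (ρ ℚ.*_) (trans (fromℕ-+ k (k ℕ.+ k)) (cong (fromℕ k ℚ.+_) (fromℕ-+ k k))) ⟩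
    ρ ℚ.* (fromℕ k ℚ.+ (fromℕ k ℚ.+ fromℕ k))             ≡⟨ ℚₚ.*-distribˡ-+ ρ (fromℕ k) _ ⟩
    ρ ℚ.* fromℕ k ℚ.+ ρ ℚ.* (fromℕ k ℚ.+ fromℕ k)         ≡⟨ cong₂ ℚ._+_ ρ*k (trans (ℚₚ.*-distribˡ-+ ρ (fromℕ k) (fromℕ k)) (cong₂ ℚ._+_ ρ*k ρ*k)) ⟩
    fromℕ 6                                               ∎
    where open ≡-Reasoning

  -- From `2^p ≤ n^q ≤ 2^((2k+1)q)` follows `p ≤ (2k+1)q`, and `2k + 1 ≤ 3k` because `k ≥ 1`. So
  -- every `p / q` in the lower cut of `log₂ n` is at most `3k`.
  ρ≤6/log₂ : ∀ n → n ℕ.< 2 ℕ.^ (k ℕ.+ suc k) → ρ ≤ fromℕ 6 /log₂ n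
  ρ≤6/log₂ n n<2^ p q 2^p≤n^q = begin
    ρ ℚ.* (+ p / q)                ≤⟨ ℚₚ.*-monoˡ-≤-nonNeg ρ (/≤fromℕ p q (k ℕ.+ (k ℕ.+ k)) p≤3kq) ⟩
    ρ ℚ.* fromℕ (k ℕ.+ (k ℕ.+ k))  ≡⟨ ρ*3k ⟩
    fromℕ 6                        ∎
    where
    open ℚₚ.≤-Reasoning
    2^p≤ : 2 ℕ.^ p ℕ.≤ 2 ℕ.^ ((k ℕ.+ suc k) ℕ.* q)
    2^p≤ = ℕₚ.≤-trans 2^p≤n^q (ℕₚ.≤-trans (ℕₚ.^-monoˡ-≤ q (ℕₚ.<⇒≤ n<2^))
      (ℕₚ.≤-reflexive (ℕₚ.^-*-assoc 2 (k ℕ.+ suc k) q)))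
    p≤3kq : p ℕ.≤ (k ℕ.+ (k ℕ.+ k)) ℕ.* q
    p≤3kq = ℕₚ.≤-trans (ℕₚ.≮⇒≥ (λ lt → ℕₚ.<⇒≱ (ℕₚ.^-monoʳ-< 2 (s≤s (s≤s z≤n)) lt) 2^p≤))
      (ℕₚ.*-monoˡ-≤ q (ℕₚ.+-monoʳ-≤ k (s≤s (ℕₚ.m≤n+m k k-1))))

-- Choice of `k` for a given `n`

bracket : (f : ℕ → ℕ) → (∀ k → f k ℕ.< f (suc k)) → ∀ n → f 0 ℕ.≤ n → ∃[ k ] (f k ℕ.≤ n × n ℕ.< f (suc k))
bracket f f< zero    f0≤0 = 0 , f0≤0 , ℕₚ.≤-<-trans z≤n (f< 0)
bracket f f< (suc n) f0≤1+n with f 0 ℕ.≤? n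
... | no  f0≰n = 0 , f0≤1+n , ℕₚ.≤-<-trans (ℕₚ.≰⇒> f0≰n) (f< 0)
... | yes f0≤n with k , fk≤n , n<f1+k ← bracket f f< n f0≤n with suc n ℕ.<? f (suc k)
...   | yes 1+n<f1+k = k , ℕₚ.m≤n⇒m≤1+n fk≤n , 1+n<f1+k
-- Here `suc n` equals `f (suc k)`, so the index moves up by exactly one.
...   | no  1+n≮f1+k = suc k , ℕₚ.≮⇒≥ 1+n≮f1+k , ℕₚ.≤-<-trans n<f1+k (f< (suc k))

corollary2p4 : ∃[ C ] (0ℚ < C × (∀ (n : ℕ) → 2 ℕ.≤ n →
    ∃[ P ] (size P ℕ.≤ n × (∃[ ρ ] (IsDensity P ρ × ρ ≤ C /log₂ n)) × ¬ Schedulable P)))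
corollary2p4 = fromℕ 6 , ℚₚ.positive⁻¹ (fromℕ 6) , λ n 2≤n →
  -- The bracketed powers have odd exponents 1, 3, 5, and so on. For subsets of size `k = suc k-1`
  -- the lower one is `2k - 1`, the exponent in `size≤`, and the upper one is `2k + 1`, as in
  -- `ρ≤6/log₂`. The first power is 2, so `2≤n` starts the search.
  let k-1 , 2^≤n , n<2^ = bracket (λ k → 2 ℕ.^ (k ℕ.+ suc k)) 2^-mono n 2≤n
      open Instance k-1
  in P , ℕₚ.≤-trans size≤ 2^≤n , (ρ , isDensity , ρ≤6/log₂ n n<2^) , ¬schedulable
  where
  2^-mono : ∀ k → 2 ℕ.^ (k ℕ.+ suc k) ℕ.< 2 ℕ.^ (suc k ℕ.+ suc (suc k))
  2^-mono k = ℕₚ.^-monoʳ-< 2 (s≤s (s≤s z≤n)) (ℕₚ.+-mono-< (ℕₚ.n<1+n k) (ℕₚ.n<1+n (suc k)))
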